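{- Let $G$ be a finite bipartite graph and let $e_1=\{b_1,w_1\},\dots,e_n=\{b_n,w_n\}$ be pairwise vertex-disjoint edges, with $b_i$ black and $w_i$ white. Let $G^e=G-\{e_1,\dots,e_n\}$ (edges deleted) and $G'=G-\{b_1,w_1,\dots,b_n,w_n\}$ (vertices deleted). Suppose that for every $i$ there is a nonempty channel $B_i\in\mathcal{C}_B(G^e)$ with $B_i\cap\{b_1,\dots,b_n\}\subseteq\{b_i\}$. Then $m_G\equiv m_{G'}\pmod 2$. If moreover $B_i\cap\{b_1,\dots,b_n\}=\{b_i\}$ for all $i$, then $|\mathcal{C}_B(G)|=|\mathcal{C}_B(G')|$.
   Context: $m_H$ is the number of perfect matchings of $H$. A channel of a graph $H$ is a vertex set $C$ such that every vertex of $H$ is adjacent to an even number of vertices of $C$ (empty set included). For bipartite $H$ with black/white coloring, $\mathcal{C}_B(H)$ is the set of channels consisting only of black vertices. -}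

module Defs where

open import Level using (0ℓ)
open import Data.Nat.Base as ℕ using (ℕ; zero; suc)
import Data.Nat.Properties as ℕ
open import Data.Nat.Divisibility using (_∣_; _∣?_)
open import Data.Fin.Base using (Fin; _<_)
open import Data.Fin.Properties using (_≟_; _<?_; all?)
open import Data.Fin.Subset
  using (Subset; inside; outside; ⁅_⁆; _∈_; _∉_; _⊆_; _∩_; _─_; ⋃; ∣_∣)
open import Data.Fin.Subset.Properties using (_∈?_; _⊆?_; x∈p∧x∉q⇒x∈p─q)
open import Data.List.Base as List
  using (List; []; _∷_; _++_; length; filter; allFin; cartesianProduct)
open import Data.Vec.Base using ([]; _∷_; tabulate)
open import Data.Product.Base using (_×_; _,_; ∃)
open import Data.Sum.Base using (_⊎_; inj₁; inj₂)
open import Function.Base using (_∘_)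
open import Relation.Binary.Core using (Rel)
open import Relation.Binary.Definitions as B using (Symmetric; Irreflexive)
open import Relation.Binary.PropositionalEquality.Core using (_≡_; _≢_; refl)
open import Relation.Nullary.Decidable.Core
  using (Dec; yes; no; does; _×-dec_; _⊎-dec_; _→-dec_; ¬?)
open import Relation.Nullary.Negation.Core using (¬_)
open import Relation.Unary using (Pred; Decidable)

private variable
  N n : ℕ

-- Each subset of Fin n is listed exactly once.
subsets : ∀ n → List (Subset n)
subsets zero    = [] ∷ []
subsets (suc n) = List.map (outside ∷_) (subsets n) ++ List.map (inside ∷_) (subsets n)

countSubsets : {P : Pred (Subset n) 0ℓ} → Decidable P → ℕ
countSubsets {n} P? = length (filter P? (subsets n))

fromDec : {P : Pred (Fin n) 0ℓ} → Decidable P → Subset n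
fromDec P? = tabulate (λ x → does (P? x))

image : (Fin n → Fin N) → Subset N
image {n} f = ⋃ (List.map (⁅_⁆ ∘ f) (allFin n))

-- A pair stands for the unordered pair of its components; _≐_ is equality of
-- unordered pairs.
Edge : ℕ → Set
Edge N = Fin N × Fin N

_≐_ : Rel (Edge N) 0ℓ
(u , v) ≐ (x , y) = (u ≡ x × v ≡ y) ⊎ (u ≡ y × v ≡ x)

_≐?_ : B.Decidable (_≐_ {N})
(u , v) ≐? (x , y) = (u ≟ x ×-dec v ≟ y) ⊎-dec (u ≟ y ×-dec v ≟ x)

_endpointOf_ : Fin N → Edge N → Set
v endpointOf (x , y) = v ≡ x ⊎ v ≡ y

_endpointOf?_ : (v : Fin N) (e : Edge N) → Dec (v endpointOf e)
v endpointOf? (x , y) = v ≟ x ⊎-dec v ≟ y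

VertexDisjoint : Rel (Edge N) 0ℓ
VertexDisjoint e f = ¬ ∃ λ v → v endpointOf e × v endpointOf f

-- Finite simple graphs whose vertex set is an arbitrary subset of Fin N, so
-- that deleting vertices does not require renaming the remaining ones.
record Graph (N : ℕ) : Set₁ where
  field
    V      : Subset N
    Adj    : Rel (Fin N) 0ℓ
    adj?   : B.Decidable Adj
    symm   : Symmetric Adj
    irrefl : Irreflexive _≡_ Adj
    Adj⇒∈V : ∀ {u v} → Adj u v → u ∈ V

  -- Each edge occurs once, oriented from its smaller to its larger endpoint.
  edges : List (Edge N)
  edges = filter (λ (u , v) → u <? v ×-dec adj? u v)
                 (cartesianProduct (allFin N) (allFin N))

  -- Sets of edges are sets of positions in the list of edges.
  EdgeSet : Set
  EdgeSet = Subset (length edges)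

  incidentEdges : Fin N → EdgeSet
  incidentEdges v = fromDec (λ k → v endpointOf? List.lookup edges k)

  neighbours : Fin N → Subset N
  neighbours v = fromDec (adj? v)

open Graph

IsPerfectMatching : (H : Graph N) → Pred (EdgeSet H) 0ℓ
IsPerfectMatching H M = ∀ v → v ∈ V H → ∣ incidentEdges H v ∩ M ∣ ≡ 1

isPerfectMatching? : (H : Graph N) → Decidable (IsPerfectMatching H)
isPerfectMatching? H M =
  all? λ v → v ∈? V H →-dec ∣ incidentEdges H v ∩ M ∣ ℕ.≟ 1

m : Graph N → ℕ
m H = countSubsets (isPerfectMatching? H)

IsChannel : Graph N → Pred (Subset N) 0ℓ
IsChannel H C = C ⊆ V H × (∀ v → v ∈ V H → 2 ∣ ∣ neighbours H v ∩ C ∣)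

isChannel? : (H : Graph N) → Decidable (IsChannel H)
isChannel? H C =
  C ⊆? V H ×-dec all? λ v → v ∈? V H →-dec 2 ∣? ∣ neighbours H v ∩ C ∣

deleteEdges : Graph N → (Fin n → Edge N) → Graph N
deleteEdges G e = record
  { V      = V G
  ; Adj    = λ u v → Adj G u v × (∀ i → ¬ (u , v) ≐ e i)
  ; adj?   = λ u v → adj? G u v ×-dec all? λ i → ¬? ((u , v) ≐? e i)
  ; symm   = λ (uv , ∉e) → symm G uv , λ i → ∉e i ∘ swap≐
  ; irrefl = λ u≡v (uv , _) → irrefl G u≡v uv
  ; Adj⇒∈V = λ (uv , _) → Adj⇒∈V G uv
  }
  where
  swap≐ : ∀ {u v} {f : Edge N} → (v , u) ≐ f → (u , v) ≐ f
  swap≐ (inj₁ (p , q)) = inj₂ (q , p)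
  swap≐ (inj₂ (p , q)) = inj₁ (q , p)

deleteVertices : Graph N → Subset N → Graph N
deleteVertices G S = record
  { V      = V G ─ S
  ; Adj    = λ u v → Adj G u v × u ∉ S × v ∉ S
  ; adj?   = λ u v → adj? G u v ×-dec ¬? (u ∈? S) ×-dec ¬? (v ∈? S)
  ; symm   = λ (uv , u∉S , v∉S) → symm G uv , v∉S , u∉S
  ; irrefl = λ u≡v (uv , _) → irrefl G u≡v uv
  ; Adj⇒∈V = λ (uv , u∉S , _) → x∈p∧x∉q⇒x∈p─q (Adj⇒∈V G uv) u∉S
  }

data Colour : Set where
  black white : Colour

_≟ᶜ_ : B.Decidable (_≡_ {A = Colour})
black ≟ᶜ black = yes refl
black ≟ᶜ white = no λ ()
white ≟ᶜ black = no λ ()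
white ≟ᶜ white = yes refl

-- Colours assigned outside the vertex set of the graph are irrelevant.
record BipartiteGraph (N : ℕ) : Set₁ where
  field
    graph  : Graph N
    colour : Fin N → Colour
    proper : ∀ {u v} → Adj graph u v → colour u ≢ colour v

open BipartiteGraph

_-edges_ : BipartiteGraph N → (Fin n → Edge N) → BipartiteGraph N
G -edges e = record
  { graph  = deleteEdges (graph G) e
  ; colour = colour G
  ; proper = λ (uv , _) → proper G uv
  }

_-vertices_ : BipartiteGraph N → Subset N → BipartiteGraph N
G -vertices S = record
  { graph  = deleteVertices (graph G) S
  ; colour = colour G
  ; proper = λ (uv , _) → proper G uv
  }

IsBlackChannel : BipartiteGraph N → Pred (Subset N) 0ℓ
IsBlackChannel H C = IsChannel (graph H) C × (∀ v → v ∈ C → colour H v ≡ black)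

isBlackChannel? : (H : BipartiteGraph N) → Decidable (IsBlackChannel H)
isBlackChannel? H C =
  isChannel? (graph H) C ×-dec all? λ v → v ∈? C →-dec colour H v ≟ᶜ black

∣𝒞ᴮ_∣ : BipartiteGraph N → ℕ
∣𝒞ᴮ H ∣ = countSubsets (isBlackChannel? H)

{-# OPTIONS --safe #-}

-- Work in 𝔽₂[x_v]/(x_v²), where the product P of 1 + x_u x_v over the edges uv of G has
-- the parity of m_G as its coefficient at V, and the parity of m_G′ as its coefficient
-- at V′. For a set C, the derivation D_C = Σ_{c ∈ C} ∂/∂x_c satisfies
-- D_C P = (Σ_v |N(v) ∩ C| x_v) P. A channel Bᵢ of Gᵉ sees in G an odd number of
-- neighbours only at wᵢ, and only if bᵢ ∈ Bᵢ. If bᵢ ∉ Bᵢ, then D_Bᵢ P = 0, and its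
-- coefficient at S − c with c ∈ Bᵢ ⊆ S is P(S), so P(V) = 0 = P(V′). If bᵢ ∈ Bᵢ, then
-- D_Bᵢ P = x_wᵢ P, and comparing coefficients at S − bᵢ gives P(S) = P(S − bᵢ − wᵢ);
-- the pairs bᵢ, wᵢ are removed one after the other.
--
-- For the channels, x ↦ x + Σ_i x(bᵢ) Bᵢ maps 𝒞ᴮ(G) to 𝒞ᴮ(G′) with inverse
-- y ↦ y + Σ_i |N(wᵢ) ∩ y| Bᵢ.
module Submission where

open import Defs
open import Algebra.Bundles using (CommutativeRing)
open import Data.Bool.Base using (Bool; true; false; not; _∧_; _xor_; if_then_else_)
open import Data.Bool.Properties as Bool
  using (xor-∧-commutativeRing; xor-assoc; xor-same; xor-identityʳ;
         not-involutive; ∧-zeroʳ; ∧-identityʳ; ∧-assoc; ∧-distribˡ-xor)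
open import Data.Bool.Solver using (module xor-∧-Solver)
open import Data.Nat.Base as ℕ using (ℕ; zero; suc; _+_; _%_)
import Data.Nat.Properties as ℕ
open import Data.Nat.Divisibility using (_∣_; divides; m%n≡0⇒n∣m)
open import Data.Fin.Base using (Fin; zero; suc; _<_)
open import Data.Fin.Properties using (_≟_; _<?_; <-cmp; <⇒≢; all?; any?; ¬∀⟶∃¬)
open import Data.Fin.Subset
  using (Subset; inside; outside; Nonempty; ⁅_⁆; ⊥; ⋃; _∈_; _∉_; _⊆_; _∩_; _∪_; _─_; ∣_∣)
open import Data.Fin.Subset.Properties
  using (x∈p∩q⁺; x∈p∩q⁻; x∈p∪q⁺; x∈p∪q⁻; x∈⁅x⁆; x∈⁅y⁆⇒x≡y; p─q⊆p; x∈p∧x∉q⇒x∈p─q;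
         ⊆-antisym; ∉⊥; _∈?_)
open import Data.List.Base as List using (List; []; _∷_; _++_; length; filter; allFin)
import Data.List.Properties as List
open import Data.List.Membership.Propositional using () renaming (_∈_ to _∈ᴸ_)
open import Data.List.Membership.Propositional.Properties
  using (∈-lookup; ∈-allFin; ∈-map⁺; ∈-map⁻; ∈-filter⁺; ∈-filter⁻; ∈-++⁺ˡ; ∈-++⁺ʳ)
open import Data.List.Membership.Propositional.Properties.WithK using (unique∧set⇒bag)
open import Data.List.Relation.Binary.BagAndSetEquality using (∼bag⇒↭)
open import Data.List.Relation.Binary.Permutation.Propositional.Properties using (↭-length)
open import Data.List.Relation.Unary.All as All using (All; []; _∷_)
open import Data.List.Relation.Unary.All.Properties as All using (all-filter)
open import Data.List.Relation.Unary.AllPairs using ([]; _∷_)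
open import Data.List.Relation.Unary.Any using (here; there)
open import Data.List.Relation.Unary.Unique.Propositional using (Unique)
import Data.List.Relation.Unary.Unique.Propositional.Properties as Unique
open import Data.Product.Base using (_×_; _,_; ∃; proj₁; proj₂)
open import Data.Sum.Base using (_⊎_; inj₁; inj₂)
open import Data.Vec.Base as Vec using ([]; _∷_; lookup; _[_]≔_; tabulate)
import Data.Vec.Properties as Vec
open import Function.Base using (_∘_)
open import Function.Bundles using (_⇔_; mk⇔; Equivalence)
open import Function.Properties.Equivalence using () renaming (trans to ⇔-trans)
open import Level using (0ℓ)
open import Relation.Binary.Definitions using (tri<; tri≈; tri>)
open import Relation.Binary.PropositionalEquality
  using (_≡_; _≢_; _≗_; refl; sym; trans; cong; cong₂; subst; module ≡-Reasoning)
open import Relation.Nullary.Decidable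
  using (Dec; yes; no; does; dec-true; dec-false; does-⇔; decidable-stable; _×-dec_)
open import Relation.Nullary.Negation using (¬_; contradiction)
open import Relation.Unary using (Pred; Decidable)

open import Algebra.Properties.Semiring.Sum
  (CommutativeRing.semiring xor-∧-commutativeRing)
  using (sum; sum-cong-≗; sum-replicate-zero; ∑-comm; ∑-distrib-+; *-distribˡ-sum; *-distribʳ-sum)

open ≡-Reasoning

private variable
  N n : ℕ

-- Sums over 𝔽₂, indexed by `Fin n` and by lists.

sum-const-false : {f : Fin n → Bool} → (∀ i → f i ≡ false) → sum f ≡ false
sum-const-false {n} f≡0 = trans (sum-cong-≗ f≡0) (sum-replicate-zero n)

sum-kronecker : (v : Fin n) (f : Fin n → Bool) → sum (λ c → does (c ≟ v) ∧ f c) ≡ f v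
sum-kronecker zero    f = trans
  (cong (f zero xor_) (sum-const-false {f = λ c → does (suc c ≟ zero) ∧ f (suc c)} λ _ → refl))
  (xor-identityʳ _)
sum-kronecker (suc v) f = sum-kronecker v (f ∘ suc)

module _ {A : Set} where

  ∑ᴸ : (A → Bool) → List A → Bool
  ∑ᴸ f = List.foldr (λ x → f x xor_) false

  ∑ᴸ-filter : {P : Pred A 0ℓ} (P? : Decidable P) (f : A → Bool) (xs : List A) →
              ∑ᴸ f (filter P? xs) ≡ ∑ᴸ (λ x → does (P? x) ∧ f x) xs
  ∑ᴸ-filter P? f []       = refl
  ∑ᴸ-filter P? f (x ∷ xs) with does (P? x)
  ... | true  = cong (f x xor_) (∑ᴸ-filter P? f xs)
  ... | false = ∑ᴸ-filter P? f xs

  ∑ᴸ-++ : (f : A → Bool) (xs ys : List A) → ∑ᴸ f (xs ++ ys) ≡ ∑ᴸ f xs xor ∑ᴸ f ys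
  ∑ᴸ-++ f []       ys = refl
  ∑ᴸ-++ f (x ∷ xs) ys =
    trans (cong (f x xor_) (∑ᴸ-++ f xs ys)) (sym (xor-assoc (f x) _ _))

  ∑ᴸ-tabulate : (f : A → Bool) (g : Fin n → A) → ∑ᴸ f (List.tabulate g) ≡ sum (f ∘ g)
  ∑ᴸ-tabulate {zero}  f g = refl
  ∑ᴸ-tabulate {suc n} f g = cong (f (g zero) xor_) (∑ᴸ-tabulate f (g ∘ suc))

∑ᴸ-map : {A B : Set} (f : B → Bool) (g : A → B) (xs : List A) →
         ∑ᴸ f (List.map g xs) ≡ ∑ᴸ (f ∘ g) xs
∑ᴸ-map f g []       = refl
∑ᴸ-map f g (x ∷ xs) = cong (f (g x) xor_) (∑ᴸ-map f g xs)

∑ᴸ-cartesianProduct : {A B : Set} (f : A × B → Bool) (xs : List A) (ys : List B) →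
  ∑ᴸ f (List.cartesianProduct xs ys) ≡ ∑ᴸ (λ x → ∑ᴸ (λ y → f (x , y)) ys) xs
∑ᴸ-cartesianProduct f []       ys = refl
∑ᴸ-cartesianProduct f (x ∷ xs) ys =
  trans (∑ᴸ-++ f (List.map (x ,_) ys) _)
        (cong₂ _xor_ (∑ᴸ-map f (x ,_) ys) (∑ᴸ-cartesianProduct f xs ys))

∑ᴸ-allFin² : (f : Fin N × Fin N → Bool) →
  ∑ᴸ f (List.cartesianProduct (allFin N) (allFin N)) ≡ sum (λ u → sum (λ v → f (u , v)))
∑ᴸ-allFin² {N} f = begin
  ∑ᴸ f (List.cartesianProduct (allFin N) (allFin N))
    ≡⟨ ∑ᴸ-cartesianProduct f (allFin N) (allFin N) ⟩
  ∑ᴸ (λ u → ∑ᴸ (λ v → f (u , v)) (allFin N)) (allFin N)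
    ≡⟨ ∑ᴸ-tabulate (λ u → ∑ᴸ (λ v → f (u , v)) (allFin N)) (λ u → u) ⟩
  sum (λ u → ∑ᴸ (λ v → f (u , v)) (allFin N))
    ≡⟨ sum-cong-≗ (λ u → ∑ᴸ-tabulate (λ v → f (u , v)) (λ v → v)) ⟩
  sum (λ u → sum (λ v → f (u , v))) ∎

-- Variables, derivations and the edge product.

-- The algebra 𝔽₂[x_v]/(x_v²): a function on subsets is the family of coefficients
-- of the squarefree monomials.
Poly : ℕ → Set
Poly N = Subset N → Bool

-- Since x_v² = 0, the monomial x_S arises in x_v g only from x_{S - v}, and only when v ∈ S.
mulX : Fin N → Poly N → Poly N
mulX v g S = lookup S v ∧ g (S [ v ]≔ outside)

-- ∂/∂x_v respects the relation x_v² = 0, because 2 x_v = 0 in characteristic two.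
∂ : Fin N → Poly N → Poly N
∂ v g S = not (lookup S v) ∧ g (S [ v ]≔ inside)

D : Subset N → Poly N → Poly N
D C g S = sum (λ c → lookup C c ∧ ∂ c g S)

-- The product of 1 + x_u x_v over the listed edges uv.
P : List (Edge N) → Poly N
P []            S = does (Vec.≡-dec Bool._≟_ S ⊥)
P ((u , v) ∷ L) S = P L S xor mulX u (mulX v (P L)) S

mulX-cong : ∀ {g h : Poly N} v → g ≗ h → mulX v g ≗ mulX v h
mulX-cong v g≗h S = cong (lookup S v ∧_) (g≗h _)

mulX-comm : ∀ u v (g : Poly N) → mulX u (mulX v g) ≗ mulX v (mulX u g)
mulX-comm u v g S with u ≟ v
... | yes refl = refl
... | no  u≢v
  rewrite Vec.lookup∘update′ (u≢v ∘ sym) S outside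
        | Vec.lookup∘update′ u≢v S outside
        | Vec.[]≔-commutes {x = outside} {y = outside} S u v u≢v
  with lookup S u | lookup S v
... | false | false = refl
... | false | true  = refl
... | true  | false = refl
... | true  | true  = refl

mulX-square : ∀ u (g : Poly N) S → mulX u (mulX u g) S ≡ false
mulX-square u g S rewrite Vec.lookup∘update u S outside = ∧-zeroʳ _

mulX-square′ : ∀ u v (g : Poly N) S → mulX u (mulX v (mulX u g)) S ≡ false
mulX-square′ u v g S =
  trans (mulX-cong u (mulX-comm v u g) S) (mulX-square u (mulX v g) S)

mulX-xor : ∀ v (g h : Poly N) S → mulX v (λ T → g T xor h T) S ≡ mulX v g S xor mulX v h S
mulX-xor v g h S = ∧-distribˡ-xor (lookup S v) _ _

mulX-∧ : ∀ v a (g : Poly N) S → mulX v (λ T → a ∧ g T) S ≡ a ∧ mulX v g S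
mulX-∧ v true  g S = refl
mulX-∧ v false g S = ∧-zeroʳ _

D-xor : ∀ C (g h : Poly N) S → D C (λ T → g T xor h T) S ≡ D C g S xor D C h S
D-xor C g h S = trans (sum-cong-≗ pointwise) (∑-distrib-+ (λ c → lookup C c ∧ ∂ c g S) _)
  where
  pointwise : ∀ c → lookup C c ∧ ∂ c (λ T → g T xor h T) S ≡
                    (lookup C c ∧ ∂ c g S) xor (lookup C c ∧ ∂ c h S)
  pointwise c with lookup C c | lookup S c
  ... | true  | true  = refl
  ... | true  | false = refl
  ... | false | _     = refl

-- The Leibniz rule. For c = v ∈ S the left side vanishes and the right side is `g S` added to
-- itself, so characteristic two is what makes it hold.
∂-mulX : ∀ c v (g : Poly N) S →
         ∂ c (mulX v g) S ≡ mulX v (∂ c g) S xor (does (c ≟ v) ∧ g S)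
∂-mulX c v g S with c ≟ v
... | yes refl
  rewrite Vec.lookup∘update c S inside | Vec.lookup∘update c S outside
        | Vec.[]≔-idempotent {x = inside} {y = outside} S c
        | Vec.[]≔-idempotent {x = outside} {y = inside} S c
  with lookup S c | Vec.[]≔-lookup S c
... | true  | eq rewrite eq = sym (xor-same (g S))
... | false | eq rewrite eq = refl
∂-mulX c v g S | no c≢v
  rewrite Vec.lookup∘update′ (c≢v ∘ sym) S inside | Vec.lookup∘update′ c≢v S outside
        | Vec.[]≔-commutes {x = inside} {y = outside} S c v c≢v
  with lookup S c | lookup S v
... | false | false = refl
... | false | true  = sym (xor-identityʳ _)
... | true  | false = refl
... | true  | true  = refl

-- The Leibniz rule summed over c ∈ C; the Kronecker terms collapse to the one with c = v.
D-mulX : ∀ C v (g : Poly N) S →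
         D C (mulX v g) S ≡ mulX v (D C g) S xor (lookup C v ∧ g S)
D-mulX C v g S = begin
  sum (λ c → lookup C c ∧ ∂ c (mulX v g) S)
    ≡⟨ sum-cong-≗ pointwise ⟩
  sum (λ c → (lookup S v ∧ (lookup C c ∧ ∂ c g (S [ v ]≔ outside))) xor
             (does (c ≟ v) ∧ (lookup C c ∧ g S)))
    ≡⟨ ∑-distrib-+ (λ c → lookup S v ∧ (lookup C c ∧ ∂ c g (S [ v ]≔ outside))) _ ⟩
  sum (λ c → lookup S v ∧ (lookup C c ∧ ∂ c g (S [ v ]≔ outside))) xor
  sum (λ c → does (c ≟ v) ∧ (lookup C c ∧ g S))
    ≡⟨ cong₂ _xor_ (sym (*-distribˡ-sum (lookup S v) (λ c → lookup C c ∧ ∂ c g (S [ v ]≔ outside))))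
                   (sum-kronecker v _) ⟩
  mulX v (D C g) S xor (lookup C v ∧ g S) ∎
  where
  pointwise : ∀ c → lookup C c ∧ ∂ c (mulX v g) S ≡
                    (lookup S v ∧ (lookup C c ∧ ∂ c g (S [ v ]≔ outside))) xor
                    (does (c ≟ v) ∧ (lookup C c ∧ g S))
  pointwise c rewrite ∂-mulX c v g S
    with lookup C c | does (c ≟ v) | lookup S v
  ... | true  | _     | _     = refl
  ... | false | true  | true  = refl
  ... | false | true  | false = refl
  ... | false | false | true  = refl
  ... | false | false | false = refl

-- Multiplication by Σ_uv∈L (C_v x_u + C_u x_v).
K : Subset N → List (Edge N) → Poly N → Poly N
K C L g S = ∑ᴸ (λ (u , v) → (lookup C v ∧ mulX u g S) xor (lookup C u ∧ mulX v g S)) L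

K-xor : ∀ C L (g h : Poly N) S → K C L (λ T → g T xor h T) S ≡ K C L g S xor K C L h S
K-xor C []            g h S = refl
K-xor C ((u , v) ∷ L) g h S
  rewrite mulX-xor u g h S | mulX-xor v g h S | K-xor C L g h S =
  solve 8 (λ a b c d e f i j →
      ((a :* (c :+ d)) :+ (b :* (e :+ f))) :+ (i :+ j) :=
      (((a :* c) :+ (b :* e)) :+ i) :+ (((a :* d) :+ (b :* f)) :+ j))
    refl (lookup C v) (lookup C u) (mulX u g S) (mulX u h S) (mulX v g S) (mulX v h S)
    (K C L g S) (K C L h S)
  where open xor-∧-Solver

-- Both operators are multiplications in a commutative algebra. In `D-P` this moves the monomial x_u
-- x_v of a new edge past `K`.
K-mulX : ∀ C L w (g : Poly N) S → K C L (mulX w g) S ≡ mulX w (K C L g) S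
K-mulX C []            w g S = sym (∧-zeroʳ _)
K-mulX C ((u , v) ∷ L) w g S
  rewrite K-mulX C L w g S | mulX-comm u w g S | mulX-comm v w g S =
  solve 6 (λ s a b x y z →
      ((a :* (s :* x)) :+ (b :* (s :* y))) :+ (s :* z) :=
      s :* (((a :* x) :+ (b :* y)) :+ z))
    refl (lookup S w) (lookup C v) (lookup C u)
    (mulX u g (S [ w ]≔ outside)) (mulX v g (S [ w ]≔ outside)) (K C L g (S [ w ]≔ outside))
  where open xor-∧-Solver

-- D C is a derivation and x_v (1 + x_u x_v) = x_v, so D C (P L) is the logarithmic
-- derivative Σ_uv∈L (C_v x_u + C_u x_v) times P L.
D-P : ∀ C (L : List (Edge N)) → D C (P L) ≗ K C L (P L)
D-P C []            S = sum-const-false pointwise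
  where
  pointwise : ∀ c → lookup C c ∧ ∂ c (P []) S ≡ false
  -- `P []` is the constant 1, supported on the empty set, and `S [ c ]≔ inside` is never empty.
  pointwise c
    rewrite dec-false (Vec.≡-dec Bool._≟_ (S [ c ]≔ inside) ⊥)
      (λ eq → contradiction
        (trans (sym (Vec.lookup∘update c S inside))
          (trans (cong (λ T → lookup T c) eq) (Vec.lookup-replicate c outside)))
        λ ())
    with lookup C c | lookup S c
  ... | true  | true  = refl
  ... | true  | false = refl
  ... | false | _     = refl
D-P C ((u , v) ∷ L) S = begin
  D C (P ((u , v) ∷ L)) S
    ≡⟨ D-xor C p (mulX u (mulX v p)) S ⟩
  D C p S xor D C (mulX u (mulX v p)) S
    ≡⟨ cong₂ _xor_ (D-P C L S) D-xxp ⟩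
  k xor ((uvk xor (lookup C v ∧ mulX u p S)) xor (lookup C u ∧ mulX v p S))
    ≡⟨ solve 4 (λ k uvk y x → k :+ ((uvk :+ y) :+ x) := (y :+ x) :+ (k :+ uvk)) refl
         k uvk (lookup C v ∧ mulX u p S) (lookup C u ∧ mulX v p S) ⟩
  ((lookup C v ∧ mulX u p S) xor (lookup C u ∧ mulX v p S)) xor (k xor uvk)
    ≡⟨ cong₂ _xor_ (cong₂ _xor_ (cong (lookup C v ∧_) (sym absorb-u)) (cong (lookup C u ∧_) (sym absorb-v)))
                   (sym K-P) ⟩
  K C ((u , v) ∷ L) (P ((u , v) ∷ L)) S ∎
  where
  open xor-∧-Solver
  p   = P L
  k   = K C L p S
  uvk = mulX u (mulX v (K C L p)) S

  D-xxp : D C (mulX u (mulX v p)) S ≡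
          (uvk xor (lookup C v ∧ mulX u p S)) xor (lookup C u ∧ mulX v p S)
  D-xxp = begin
    D C (mulX u (mulX v p)) S
      ≡⟨ D-mulX C u (mulX v p) S ⟩
    mulX u (D C (mulX v p)) S xor (lookup C u ∧ mulX v p S)
      ≡⟨ cong (_xor (lookup C u ∧ mulX v p S)) (mulX-cong u (D-mulX C v p) S) ⟩
    mulX u (λ T → mulX v (D C p) T xor (lookup C v ∧ p T)) S xor (lookup C u ∧ mulX v p S)
      ≡⟨ cong (_xor (lookup C u ∧ mulX v p S)) (mulX-xor u (mulX v (D C p)) (λ T → lookup C v ∧ p T) S) ⟩
    (mulX u (mulX v (D C p)) S xor mulX u (λ T → lookup C v ∧ p T) S) xor (lookup C u ∧ mulX v p S)
      ≡⟨ cong (_xor (lookup C u ∧ mulX v p S)) 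
           (cong₂ _xor_ (mulX-cong u (mulX-cong v (D-P C L)) S) (mulX-∧ u (lookup C v) p S)) ⟩
    (uvk xor (lookup C v ∧ mulX u p S)) xor (lookup C u ∧ mulX v p S) ∎

  absorb-u : mulX u (P ((u , v) ∷ L)) S ≡ mulX u p S
  absorb-u = trans (mulX-xor u p (mulX u (mulX v p)) S)
    (trans (cong (mulX u p S xor_) (mulX-square u (mulX v p) S)) (xor-identityʳ _))

  absorb-v : mulX v (P ((u , v) ∷ L)) S ≡ mulX v p S
  absorb-v = trans (mulX-xor v p (mulX u (mulX v p)) S)
    (trans (cong (mulX v p S xor_) (mulX-square′ v u p S)) (xor-identityʳ _))

  K-P : K C L (P ((u , v) ∷ L)) S ≡ k xor uvk
  K-P = trans (K-xor C L p (mulX u (mulX v p)) S)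
    (cong (k xor_) (trans (K-mulX C L u (mulX v p) S) (mulX-cong u (K-mulX C L v p) S)))

-- At S - c the derivation ∂_d contributes only for d outside S - c. All of C except c lies in S -
-- c, so only ∂_c remains, and it puts c back.
D-at : ∀ (C S : Subset N) c (g : Poly N) → c ∈ C → c ∈ S → (∀ d → d ∈ C → d ≢ c → d ∈ S) →
       D C g (S [ c ]≔ outside) ≡ g S
D-at C S c g c∈C c∈S C-c⊆S = trans (sum-cong-≗ pointwise) (sum-kronecker c (λ _ → g S))
  where
  pointwise : ∀ d → lookup C d ∧ ∂ d g (S [ c ]≔ outside) ≡ does (d ≟ c) ∧ g S
  pointwise d with d ≟ c
  ... | yes refl
    rewrite Vec.[]=⇒lookup c∈C | Vec.lookup∘update d S outside
          | Vec.[]≔-idempotent {x = outside} {y = inside} S d =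
    cong g (trans (cong (S [ d ]≔_) (sym (Vec.[]=⇒lookup c∈S))) (Vec.[]≔-lookup S d))
  ... | no d≢c with lookup C d in d∈C
  ...   | false = refl
  ...   | true
    rewrite Vec.lookup∘update′ d≢c S outside
          | Vec.[]=⇒lookup (C-c⊆S d (Vec.lookup⇒[]= d C d∈C) d≢c) = refl

-- Degrees modulo 2 and derivatives of the edge product.

open Graph

-- The parity of |N(w) ∩ C|, that is, the entry at w of the adjacency matrix over 𝔽₂ applied to C.
degree : Graph N → Subset N → Fin N → Bool
degree H C w = sum (λ v → does (adj? H w v) ∧ lookup C v)

adj-sym : ∀ (H : Graph N) u v → does (adj? H u v) ≡ does (adj? H v u)
adj-sym H u v with adj? H u v | adj? H v u
... | yes _  | yes _  = refl
... | no _   | no _   = refl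
... | yes uv | no ¬vu = contradiction (symm H uv) ¬vu
... | no ¬uv | yes vu = contradiction (symm H vu) ¬uv

-- Exactly one of the two orientations of a pair u ≠ v is increasing, and irreflexivity settles u =
-- v.
adj-oriented : ∀ (H : Graph N) u v →
  (does (u <? v) ∧ does (adj? H u v)) xor (does (v <? u) ∧ does (adj? H v u)) ≡ does (adj? H u v)
adj-oriented H u v with <-cmp u v
... | tri< u<v _ v≮u rewrite dec-true (u <? v) u<v | dec-false (v <? u) v≮u = xor-identityʳ _
... | tri> u≮v _ v<u rewrite dec-false (u <? v) u≮v | dec-true (v <? u) v<u = adj-sym H v u
... | tri≈ u≮v u≡v v≮u
  rewrite dec-false (u <? v) u≮v | dec-false (v <? u) v≮u
        | dec-false (adj? H u v) (irrefl H u≡v) = refl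

-- Collecting the terms of Σ_uv (C_v x_u + C_u x_v) by variable, the coefficient of x_w sums C over
-- the neighbours of w.
K-edges : ∀ (H : Graph N) C (g : Poly N) S →
          K C (edges H) g S ≡ sum (λ w → degree H C w ∧ mulX w g S)
K-edges {N} H C g S = begin
  K C (edges H) g S
    ≡⟨ ∑ᴸ-filter _ f (List.cartesianProduct (allFin N) (allFin N)) ⟩
  ∑ᴸ (λ (u , v) → o u v ∧ f (u , v)) (List.cartesianProduct (allFin N) (allFin N))
    ≡⟨ ∑ᴸ-allFin² (λ (u , v) → o u v ∧ f (u , v)) ⟩
  sum (λ u → sum (λ v → o u v ∧ f (u , v)))
    ≡⟨ sum-cong-≗ (λ u → trans (sum-cong-≗ (λ v → ∧-distribˡ-xor (o u v) _ _))
                               (∑-distrib-+ (λ v → o u v ∧ r u v) (λ v → o u v ∧ r v u))) ⟩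
  sum (λ u → sum (λ v → o u v ∧ r u v) xor sum (λ v → o u v ∧ r v u))
    ≡⟨ ∑-distrib-+ (λ u → sum (λ v → o u v ∧ r u v)) _ ⟩
  sum (λ u → sum (λ v → o u v ∧ r u v)) xor sum (λ u → sum (λ v → o u v ∧ r v u))
    -- Exchanging the indices in the second half gives both halves the term `r u v`, now weighted by
    -- opposite orientations.
    ≡⟨ cong (sum (λ u → sum (λ v → o u v ∧ r u v)) xor_) (∑-comm (λ u v → o u v ∧ r v u)) ⟩
  sum (λ u → sum (λ v → o u v ∧ r u v)) xor sum (λ u → sum (λ v → o v u ∧ r u v))
    ≡⟨ ∑-distrib-+ (λ u → sum (λ v → o u v ∧ r u v)) _ ⟨
  sum (λ u → sum (λ v → o u v ∧ r u v) xor sum (λ v → o v u ∧ r u v))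
    ≡⟨ sum-cong-≗ row ⟩
  sum (λ u → degree H C u ∧ mulX u g S) ∎
  where
  o : Fin N → Fin N → Bool
  o u v = does (u <? v) ∧ does (adj? H u v)

  r : Fin N → Fin N → Bool
  r u v = lookup C v ∧ mulX u g S

  f : Edge N → Bool
  f (u , v) = r u v xor r v u

  entry : ∀ u v → (o u v ∧ r u v) xor (o v u ∧ r u v) ≡
                  (does (adj? H u v) ∧ lookup C v) ∧ mulX u g S
  entry u v = trans (solve 3 (λ a b c → (a :* c) :+ (b :* c) := (a :+ b) :* c) refl (o u v) (o v u) (r u v))
    (trans (cong (_∧ r u v) (adj-oriented H u v)) (sym (∧-assoc (does (adj? H u v)) (lookup C v) (mulX u g S))))
    where open xor-∧-Solver

  row : ∀ u → sum (λ v → o u v ∧ r u v) xor sum (λ v → o v u ∧ r u v) ≡ degree H C u ∧ mulX u g S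
  row u = begin
    sum (λ v → o u v ∧ r u v) xor sum (λ v → o v u ∧ r u v)
      ≡⟨ ∑-distrib-+ (λ v → o u v ∧ r u v) _ ⟨
    sum (λ v → (o u v ∧ r u v) xor (o v u ∧ r u v))
      ≡⟨ sum-cong-≗ (entry u) ⟩
    sum (λ v → (does (adj? H u v) ∧ lookup C v) ∧ mulX u g S)
      ≡⟨ *-distribʳ-sum (mulX u g S) (λ v → does (adj? H u v) ∧ lookup C v) ⟨
    degree H C u ∧ mulX u g S ∎

-- Only the term at `w₀` survives in Σ_w deg(w) x_w. The bit `a` will be the membership of bᵢ in Bᵢ,
-- so one statement serves both cases.
D-P-single : ∀ (H : Graph N) C w₀ a → (∀ w → degree H C w ≡ does (w ≟ w₀) ∧ a) →
             ∀ S → D C (P (edges H)) S ≡ a ∧ mulX w₀ (P (edges H)) S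
D-P-single H C w₀ a deg S = begin
  D C p S                                         ≡⟨ D-P C (edges H) S ⟩
  K C (edges H) p S                               ≡⟨ K-edges H C p S ⟩
  sum (λ w → degree H C w ∧ mulX w p S)           ≡⟨ sum-cong-≗ (λ w → trans (cong (_∧ mulX w p S) (deg w))
                                                       (∧-assoc (does (w ≟ w₀)) a (mulX w p S))) ⟩
  sum (λ w → does (w ≟ w₀) ∧ (a ∧ mulX w p S))    ≡⟨ sum-kronecker w₀ _ ⟩
  a ∧ mulX w₀ p S                                 ∎
  where p = P (edges H)

module _ (H : Graph N) (C : Subset N) (c w₀ : Fin N) (c∈C : c ∈ C) where

  P-even : (∀ w → degree H C w ≡ does (w ≟ w₀) ∧ false) →
           ∀ S → C ⊆ S → P (edges H) S ≡ false
  P-even deg S C⊆S = begin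
    P (edges H) S
      ≡⟨ D-at C S c (P (edges H)) c∈C (C⊆S c∈C) (λ d d∈C _ → C⊆S d∈C) ⟨
    D C (P (edges H)) (S [ c ]≔ outside)
      ≡⟨ D-P-single H C w₀ false deg (S [ c ]≔ outside) ⟩
    false ∎

  -- Coefficients are compared at S - c: the derivative gives P(S), and x_{w₀} P gives P(S - c - w₀)
  -- because `w₀` still lies in S - c.
  P-remove : (∀ w → degree H C w ≡ does (w ≟ w₀) ∧ true) → w₀ ≢ c →
             ∀ S → c ∈ S → w₀ ∈ S → (∀ d → d ∈ C → d ≢ c → d ∈ S) →
             P (edges H) S ≡ P (edges H) ((S [ c ]≔ outside) [ w₀ ]≔ outside)
  P-remove deg w₀≢c S c∈S w₀∈S C-c⊆S = begin
    P (edges H) S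
      ≡⟨ D-at C S c (P (edges H)) c∈C c∈S C-c⊆S ⟨
    D C (P (edges H)) (S [ c ]≔ outside)
      ≡⟨ D-P-single H C w₀ true deg (S [ c ]≔ outside) ⟩
    mulX w₀ (P (edges H)) (S [ c ]≔ outside)
      ≡⟨ cong (_∧ P (edges H) ((S [ c ]≔ outside) [ w₀ ]≔ outside))
           (trans (Vec.lookup∘update′ w₀≢c S outside) (Vec.[]=⇒lookup w₀∈S)) ⟩
    P (edges H) ((S [ c ]≔ outside) [ w₀ ]≔ outside) ∎

-- Parities of numbers, cardinalities and counts.

odd : ℕ → Bool
odd zero    = false
odd (suc k) = not (odd k)

odd-+ : ∀ k l → odd (k + l) ≡ odd k xor odd l
odd-+ zero    l = refl
odd-+ (suc k) l = trans (cong not (odd-+ k l)) (Bool.not-distribˡ-xor (odd k) (odd l))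

odd≡⇒%2≡ : ∀ k l → odd k ≡ odd l → k % 2 ≡ l % 2
odd≡⇒%2≡ k l eq = trans (%2 k) (trans (cong (if_then 1 else 0) eq) (sym (%2 l)))
  where
  %2 : ∀ k → k % 2 ≡ (if odd k then 1 else 0)
  %2 zero          = refl
  %2 (suc zero)    = refl
  %2 (suc (suc k)) = trans (%2 k) (cong (if_then 1 else 0) (sym (not-involutive (odd k))))

odd-*2 : ∀ q → odd (q ℕ.* 2) ≡ false
odd-*2 zero    = refl
odd-*2 (suc q) = trans (not-involutive _) (odd-*2 q)

2∣⇒even : ∀ {k} → 2 ∣ k → odd k ≡ false
2∣⇒even (divides q refl) = odd-*2 q

even⇒2∣ : ∀ k → odd k ≡ false → 2 ∣ k
even⇒2∣ k even = m%n≡0⇒n∣m k 2 (odd≡⇒%2≡ k 0 even)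

χ : Bool → ℕ
χ a = if a then 1 else 0

∣∷∣ : ∀ a (p : Subset n) → ∣ a ∷ p ∣ ≡ χ a + ∣ p ∣
∣∷∣ true  p = refl
∣∷∣ false p = refl

odd-∣∣ : (p : Subset n) → odd ∣ p ∣ ≡ sum (lookup p)
odd-∣∣ []          = refl
odd-∣∣ (true  ∷ p) = cong not (odd-∣∣ p)
odd-∣∣ (false ∷ p) = odd-∣∣ p

length-filter-map : {A B : Set} {P : Pred B 0ℓ} (P? : Decidable P) (f : A → B) (xs : List A) →
                    length (filter P? (List.map f xs)) ≡ length (filter (P? ∘ f) xs)
length-filter-map P? f []       = refl
length-filter-map P? f (x ∷ xs) with does (P? (f x))
... | true  = cong suc (length-filter-map P? f xs)
... | false = length-filter-map P? f xs

countSubsets-suc : {Q : Pred (Subset (suc n)) 0ℓ} (Q? : Decidable Q) →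
  countSubsets Q? ≡ countSubsets (Q? ∘ (outside ∷_)) + countSubsets (Q? ∘ (inside ∷_))
countSubsets-suc {n} Q? = begin
  length (filter Q? (List.map (outside ∷_) (subsets n) ++ List.map (inside ∷_) (subsets n)))
    ≡⟨ cong length (List.filter-++ Q? (List.map (outside ∷_) (subsets n)) _) ⟩
  length (filter Q? (List.map (outside ∷_) (subsets n)) ++ filter Q? (List.map (inside ∷_) (subsets n)))
    ≡⟨ List.length-++ (filter Q? (List.map (outside ∷_) (subsets n))) ⟩
  length (filter Q? (List.map (outside ∷_) (subsets n))) + length (filter Q? (List.map (inside ∷_) (subsets n)))
    ≡⟨ cong₂ _+_ (length-filter-map Q? (outside ∷_) (subsets n)) (length-filter-map Q? (inside ∷_) (subsets n)) ⟩
  countSubsets (Q? ∘ (outside ∷_)) + countSubsets (Q? ∘ (inside ∷_)) ∎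

countSubsets-none : {Q : Pred (Subset n) 0ℓ} (Q? : Decidable Q) → (∀ M → ¬ Q M) → countSubsets Q? ≡ 0
countSubsets-none {n} Q? ¬Q = cong length (List.filter-none Q? (All.universal ¬Q (subsets n)))

-- Perfect matchings as coefficients of the edge product.

incidence : (L : List (Edge N)) → Subset (length L) → Fin N → ℕ
incidence L M v = ∣ fromDec (λ k → v endpointOf? List.lookup L k) ∩ M ∣

-- The count is prescribed at every vertex of `Fin N`, being 0 off S, so that choosing an edge just
-- removes its ends from S and recursion on the list applies.
Covers : (L : List (Edge N)) → Subset N → Pred (Subset (length L)) 0ℓ
Covers L S M = ∀ v → incidence L M v ≡ χ (lookup S v)

incidence-∷ : ∀ (e : Edge N) L a M v →
              incidence (e ∷ L) (a ∷ M) v ≡ χ (does (v endpointOf? e) ∧ a) + incidence L M v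
incidence-∷ e L a M v =
  ∣∷∣ (does (v endpointOf? e) ∧ a) (fromDec (λ k → v endpointOf? List.lookup L k) ∩ M)

Covers-outside : ∀ (e : Edge N) L S M → Covers (e ∷ L) S (outside ∷ M) ⇔ Covers L S M
Covers-outside e L S M = mk⇔ (λ cov v → trans (sym (eq v)) (cov v)) (λ cov v → trans (eq v) (cov v))
  where
  eq : ∀ v → incidence (e ∷ L) (outside ∷ M) v ≡ incidence L M v
  eq v = trans (incidence-∷ e L outside M v)
    (cong (λ a → χ a + incidence L M v) (∧-zeroʳ (does (v endpointOf? e))))

Covers-inside⁻ : ∀ {u v : Fin N} L S M → Covers ((u , v) ∷ L) S (inside ∷ M) →
                 ∀ x → x endpointOf (u , v) → lookup S x ≡ true
Covers-inside⁻ {u = u} {v} L S M cov x x∈e with lookup S x | cov x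
... | true  | _ = refl
... | false | c = contradiction
  (trans (sym c) (trans (incidence-∷ (u , v) L inside M x)
    (cong (λ a → χ (a ∧ inside) + incidence L M x) (dec-true (x endpointOf? (u , v)) x∈e))))
  λ ()

-- The chosen edge accounts for exactly one unit of the prescribed count at each of its ends and
-- none elsewhere; this unit cancels.
Covers-inside : ∀ {u v : Fin N} L S M → lookup S u ≡ true → lookup S v ≡ true →
  Covers ((u , v) ∷ L) S (inside ∷ M) ⇔ Covers L ((S [ u ]≔ outside) [ v ]≔ outside) M
Covers-inside {u = u} {v} L S M u∈S v∈S = mk⇔
  (λ cov x → ℕ.+-cancelˡ-≡ (χ (does (x endpointOf? (u , v)))) _ _
    (trans (sym (eq x)) (trans (cov x) (lookup-S x))))
  (λ cov x → trans (eq x) (trans (cong (χ (does (x endpointOf? (u , v))) +_) (cov x)) (sym (lookup-S x))))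
  where
  S′ = (S [ u ]≔ outside) [ v ]≔ outside

  eq : ∀ x → incidence ((u , v) ∷ L) (inside ∷ M) x ≡ χ (does (x endpointOf? (u , v))) + incidence L M x
  eq x = trans (incidence-∷ (u , v) L inside M x)
    (cong (λ a → χ a + incidence L M x) (∧-identityʳ (does (x endpointOf? (u , v)))))

  lookup-S : ∀ x → χ (lookup S x) ≡ χ (does (x endpointOf? (u , v))) + χ (lookup S′ x)
  lookup-S x with x ≟ v
  ... | yes refl rewrite Vec.lookup∘update x (S [ u ]≔ outside) outside
                      | v∈S | Bool.∨-zeroʳ (does (x ≟ u)) = refl
  ... | no x≢v rewrite Vec.lookup∘update′ x≢v (S [ u ]≔ outside) outside with x ≟ u
  ...   | yes refl rewrite Vec.lookup∘update x S outside | u∈S = refl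
  ...   | no x≢u rewrite Vec.lookup∘update′ x≢u S outside = refl

-- Expanding the factor 1 + x_u x_v corresponds to leaving out or choosing the edge uv. An arbitrary
-- decidable `Q` equivalent to `Covers` is allowed because the recursion passes to
-- `Q? ∘ (outside ∷_)` and `Q? ∘ (inside ∷_)`.
odd-count-Covers : ∀ (L : List (Edge N)) → All (λ (u , v) → u ≢ v) L → ∀ S →
  {Q : Pred (Subset (length L)) 0ℓ} (Q? : Decidable Q) → (∀ M → Q M ⇔ Covers L S M) →
  odd (countSubsets Q?) ≡ P L S
odd-count-Covers [] [] S Q? Q⇔ with Q? [] | Vec.≡-dec Bool._≟_ S ⊥
... | yes _ | yes _    = refl
... | no _  | no _     = refl
... | yes q | no S≢⊥   = contradiction (lookup⇒≡ λ v → χ-false (Equivalence.to (Q⇔ []) q v)) S≢⊥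
  where
  χ-false : ∀ {a} → 0 ≡ χ a → a ≡ false
  χ-false {false} _ = refl
  lookup⇒≡ : (∀ v → lookup S v ≡ false) → S ≡ ⊥
  lookup⇒≡ eq = trans (sym (Vec.tabulate∘lookup S)) (trans (Vec.tabulate-cong eq)
    (trans (Vec.tabulate-cong (λ v → sym (Vec.lookup-replicate v outside))) (Vec.tabulate∘lookup ⊥)))
... | no ¬q | yes refl =
  contradiction (Equivalence.from (Q⇔ []) λ v → cong χ (sym (Vec.lookup-replicate v outside))) ¬q
odd-count-Covers ((u , v) ∷ L) (u≢v ∷ u≢vs) S Q? Q⇔ = begin
  odd (countSubsets Q?)
    ≡⟨ cong odd (countSubsets-suc Q?) ⟩
  odd (countSubsets (Q? ∘ (outside ∷_)) + countSubsets (Q? ∘ (inside ∷_)))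
    ≡⟨ odd-+ (countSubsets (Q? ∘ (outside ∷_))) _ ⟩
  odd (countSubsets (Q? ∘ (outside ∷_))) xor odd (countSubsets (Q? ∘ (inside ∷_)))
    ≡⟨ cong₂ _xor_ (odd-count-Covers L u≢vs S (Q? ∘ (outside ∷_))
                      λ M → ⇔-trans (Q⇔ (outside ∷ M)) (Covers-outside (u , v) L S M))
                   count-inside ⟩
  P L S xor mulX u (mulX v (P L)) S ∎
  where
  impossible : ∀ x → x endpointOf (u , v) → lookup S x ≡ false → odd (countSubsets (Q? ∘ (inside ∷_))) ≡ false
  impossible x x∈e x∉S = cong odd (countSubsets-none (Q? ∘ (inside ∷_)) λ M q →
    contradiction (trans (sym x∉S) (Covers-inside⁻ L S M (Equivalence.to (Q⇔ (inside ∷ M)) q) x x∈e)) λ ())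

  count-inside : odd (countSubsets (Q? ∘ (inside ∷_))) ≡ mulX u (mulX v (P L)) S
  -- As u ≠ v, the inner test of v in S - u is a test of v in S.
  count-inside rewrite Vec.lookup∘update′ (u≢v ∘ sym) S outside
    with lookup S u in u∈S | lookup S v in v∈S
  ... | false | _     = impossible u (inj₁ refl) u∈S
  ... | true  | false = impossible v (inj₂ refl) v∈S
  ... | true  | true  = odd-count-Covers L u≢vs ((S [ u ]≔ outside) [ v ]≔ outside) (Q? ∘ (inside ∷_))
    λ M → ⇔-trans (Q⇔ (inside ∷ M)) (Covers-inside L S M u∈S v∈S)

∣∣≡0 : (p : Subset n) → (∀ k → lookup p k ≡ false) → ∣ p ∣ ≡ 0
∣∣≡0 []          _  = refl
∣∣≡0 (false ∷ p) eq = ∣∣≡0 p (eq ∘ suc)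
∣∣≡0 (true  ∷ p) eq = contradiction (eq zero) λ ()

edges-oriented : ∀ (H : Graph N) → All (λ (u , v) → u < v × Adj H u v) (edges H)
edges-oriented {N} H = all-filter (λ (u , v) → u <? v ×-dec adj? H u v)
                                  (List.cartesianProduct (allFin N) (allFin N))

-- Vertices off `V H` meet no edge, so a perfect matching automatically has the count 0 that
-- `Covers` demands there.
odd-m : ∀ (H : Graph N) → odd (m H) ≡ P (edges H) (V H)
odd-m H = odd-count-Covers (edges H) (All.map (<⇒≢ ∘ proj₁) (edges-oriented H)) (V H)
  (isPerfectMatching? H) λ M → mk⇔ (to M) (from M)
  where
  from : ∀ M → Covers (edges H) (V H) M → IsPerfectMatching H M
  from M cov v v∈V = trans (cov v) (cong χ (Vec.[]=⇒lookup v∈V))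

  isolated : ∀ v → lookup (V H) v ≡ false → ∀ k → ¬ v endpointOf List.lookup (edges H) k
  isolated v v∉V k v∈e with All.lookup (edges-oriented H) (∈-lookup k) | v∈e
  ... | _ , uv | inj₁ refl = contradiction (trans (sym v∉V) (Vec.[]=⇒lookup (Adj⇒∈V H uv))) λ ()
  ... | _ , uv | inj₂ refl = contradiction (trans (sym v∉V) (Vec.[]=⇒lookup (Adj⇒∈V H (symm H uv)))) λ ()

  to : ∀ M → IsPerfectMatching H M → Covers (edges H) (V H) M
  to M pm v with lookup (V H) v in v∈V
  ... | true  = pm v (Vec.lookup⇒[]= v (V H) v∈V)
  ... | false = ∣∣≡0 (incidentEdges H v ∩ M) λ k → trans (Vec.lookup-zipWith _∧_ k (incidentEdges H v) M)
    (cong (_∧ lookup M k) (trans (Vec.lookup∘tabulate _ k)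
      (dec-false (v endpointOf? List.lookup (edges H) k) (isolated v v∈V k))))

-- The edge product of a subgraph.

P-filter-∷ : {A : Pred (Edge N) 0ℓ} (A? : Decidable A) (u v : Fin N) (L : List (Edge N)) (S : Subset N) →
  P (filter A? ((u , v) ∷ L)) S ≡
  P (filter A? L) S xor (does (A? (u , v)) ∧ mulX u (mulX v (P (filter A? L))) S)
P-filter-∷ A? u v L S with does (A? (u , v))
... | true  = refl
... | false = sym (xor-identityʳ _)

lookup-≔-outside : ∀ (S : Subset N) u v → lookup (S [ u ]≔ outside) v ≡ true → lookup S v ≡ true
lookup-≔-outside S u v eq with v ≟ u
... | yes refl = contradiction (trans (sym eq) (Vec.lookup∘update v S outside)) λ ()
... | no v≢u   = trans (sym (Vec.lookup∘update′ v≢u S outside)) eq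

-- The coefficient at S sees only edges with both ends in S. The sets in the recursion shrink, so
-- agreement of the filters on S is inherited.
P-filter-cong : {A B : Pred (Edge N) 0ℓ} (A? : Decidable A) (B? : Decidable B)
  (L : List (Edge N)) (S : Subset N) →
  (∀ u v → lookup S u ≡ true → lookup S v ≡ true → does (A? (u , v)) ≡ does (B? (u , v))) →
  P (filter A? L) S ≡ P (filter B? L) S
P-filter-cong A? B? []            S A≡B = refl
P-filter-cong A? B? ((u , v) ∷ L) S A≡B = begin
  P (filter A? ((u , v) ∷ L)) S
    ≡⟨ P-filter-∷ A? u v L S ⟩
  P (filter A? L) S xor (does (A? (u , v)) ∧ mulX u (mulX v (P (filter A? L))) S)
    ≡⟨ cong₂ _xor_ (P-filter-cong A? B? L S A≡B) with-edge ⟩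
  P (filter B? L) S xor (does (B? (u , v)) ∧ mulX u (mulX v (P (filter B? L))) S)
    ≡⟨ P-filter-∷ B? u v L S ⟨
  P (filter B? ((u , v) ∷ L)) S ∎
  where
  with-edge : does (A? (u , v)) ∧ mulX u (mulX v (P (filter A? L))) S ≡
              does (B? (u , v)) ∧ mulX u (mulX v (P (filter B? L))) S
  with-edge with lookup S u in u∈S | lookup (S [ u ]≔ outside) v in v∈S
  -- With an end missing from S the edge term is 0, whatever the filters decide.
  ... | false | _     = trans (∧-zeroʳ (does (A? (u , v)))) (sym (∧-zeroʳ (does (B? (u , v)))))
  ... | true  | false = trans (∧-zeroʳ (does (A? (u , v)))) (sym (∧-zeroʳ (does (B? (u , v)))))
  ... | true  | true  = cong₂ _∧_ (A≡B u v u∈S (lookup-≔-outside S u v v∈S))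
    (P-filter-cong A? B? L ((S [ u ]≔ outside) [ v ]≔ outside) λ x y x∈S y∈S →
      A≡B x y (lookup-≔-outside S u x (lookup-≔-outside (S [ u ]≔ outside) v x x∈S))
              (lookup-≔-outside S u y (lookup-≔-outside (S [ u ]≔ outside) v y y∈S)))

-- Counting subsets through bijections.

-- Injectivity is asked for on `Q` alone, because the maps between channels are shown to be mutually
-- inverse only on channels.
Unique-map⁺ : {A B : Set} {Q : Pred A 0ℓ} (f : A → B) → (∀ {x y} → Q x → Q y → f x ≡ f y → x ≡ y) →
              {xs : List A} → All Q xs → Unique xs → Unique (List.map f xs)
Unique-map⁺ f inj []         []           = []
Unique-map⁺ f inj (qx ∷ qxs) (x≢xs ∷ xs!) =
  All.map⁺ (All.zipWith (λ (x≢y , qy) fx≡fy → x≢y (inj qx qy fx≡fy)) (x≢xs , qxs)) ∷ Unique-map⁺ f inj qxs xs!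

subsets-unique : ∀ n → Unique (subsets n)
subsets-unique zero    = [] ∷ []
subsets-unique (suc n) = Unique.++⁺
  (Unique.map⁺ Vec.∷-injectiveʳ (subsets-unique n)) (Unique.map⁺ Vec.∷-injectiveʳ (subsets-unique n))
  λ (p∈out , p∈in) → out≢in (∈-map⁻ _ p∈out) (∈-map⁻ _ p∈in)
  where
  out≢in : ∀ {xs p} → ∃ (λ q → q ∈ᴸ xs × p ≡ outside ∷ q) → ¬ ∃ (λ q → q ∈ᴸ xs × p ≡ inside ∷ q)
  out≢in (_ , _ , refl) (_ , _ , ())

∈-subsets : (p : Subset n) → p ∈ᴸ subsets n
∈-subsets []            = here refl
∈-subsets (outside ∷ p) = ∈-++⁺ˡ (∈-map⁺ (outside ∷_) (∈-subsets p))
∈-subsets {suc n} (inside  ∷ p) =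
  ∈-++⁺ʳ (List.map (outside ∷_) (subsets n)) (∈-map⁺ (inside ∷_) (∈-subsets p))

-- `subsets` has no repetitions, and duplicate-free lists with the same members are permutations of
-- each other.
countSubsets-bijection : {Q R : Pred (Subset n) 0ℓ} (Q? : Decidable Q) (R? : Decidable R)
  (f g : Subset n → Subset n) → (∀ {x} → Q x → R (f x)) → (∀ {y} → R y → Q (g y)) →
  (∀ {x} → Q x → g (f x) ≡ x) → (∀ {y} → R y → f (g y) ≡ y) →
  countSubsets Q? ≡ countSubsets R?
countSubsets-bijection {n} {Q} {R} Q? R? f g Q⇒R R⇒Q gf fg =
  trans (sym (List.length-map f qs)) (↭-length (∼bag⇒↭ (unique∧set⇒bag
    (Unique-map⁺ f (λ qx qy eq → trans (sym (gf qx)) (trans (cong g eq) (gf qy)))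
      (all-filter Q? (subsets n)) (Unique.filter⁺ Q? (subsets-unique n)))
    (Unique.filter⁺ R? (subsets-unique n))
    (mk⇔ to from))))
  where
  qs = filter Q? (subsets n)
  rs = filter R? (subsets n)

  to : ∀ {y} → y ∈ᴸ List.map f qs → y ∈ᴸ rs
  to y∈ with ∈-map⁻ f y∈
  ... | x , x∈ , refl = ∈-filter⁺ R? (∈-subsets (f x)) (Q⇒R (proj₂ (∈-filter⁻ Q? {xs = subsets n} x∈)))

  from : ∀ {y} → y ∈ᴸ rs → y ∈ᴸ List.map f qs
  from {y} y∈ = let Ry = proj₂ (∈-filter⁻ R? {xs = subsets n} y∈) in
    subst (_∈ᴸ List.map f qs) (fg Ry) (∈-map⁺ f (∈-filter⁺ Q? (∈-subsets (g y)) (R⇒Q Ry)))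

-- Membership in differences, updates and images.

∉⇒lookup : ∀ {v} {p : Subset N} → v ∉ p → lookup p v ≡ false
∉⇒lookup {v = v} {p} v∉p with lookup p v in eq
... | true  = contradiction (Vec.lookup⇒[]= v p eq) v∉p
... | false = refl

lookup-false⇒∉ : ∀ {v} {p : Subset N} → lookup p v ≡ false → v ∉ p
lookup-false⇒∉ eq v∈p = contradiction (trans (sym eq) (Vec.[]=⇒lookup v∈p)) λ ()

∈─⇒∉ : ∀ {v} (p q : Subset N) → v ∈ p ─ q → v ∉ q
∈─⇒∉ (_ ∷ p) (inside  ∷ q) ()          Vec.here
∈─⇒∉ (_ ∷ p) (_       ∷ q) (Vec.there v∈) (Vec.there v∈q) = ∈─⇒∉ p q v∈ v∈q

∈-≔⁺ : ∀ {v c} {S : Subset N} → v ∈ S → v ≢ c → v ∈ S [ c ]≔ outside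
∈-≔⁺ {v = v} {S = S} v∈S v≢c =
  Vec.lookup⇒[]= v _ (trans (Vec.lookup∘update′ v≢c S outside) (Vec.[]=⇒lookup v∈S))

∈-≔⁻ : ∀ {v c} {S : Subset N} → v ∈ S [ c ]≔ outside → v ∈ S × v ≢ c
∈-≔⁻ {v = v} {c} {S} v∈ =
  Vec.lookup⇒[]= v S (lookup-≔-outside S c v (Vec.[]=⇒lookup v∈)) ,
  λ { refl → lookup-false⇒∉ (Vec.lookup∘update v S outside) v∈ }

∈-image⁺ : ∀ (f : Fin n → Fin N) i → f i ∈ image f
∈-image⁺ f i = go (∈-allFin i)
  where
  go : ∀ {l} → i ∈ᴸ l → f i ∈ ⋃ (List.map (⁅_⁆ ∘ f) l)
  go (here refl) = x∈p∪q⁺ (inj₁ (x∈⁅x⁆ (f i)))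
  go (there i∈l) = x∈p∪q⁺ (inj₂ (go i∈l))

∈-image⁻ : ∀ (f : Fin n → Fin N) {v} → v ∈ image f → ∃ λ i → v ≡ f i
∈-image⁻ {n} f = go (allFin n)
  where
  go : ∀ l {v} → v ∈ ⋃ (List.map (⁅_⁆ ∘ f) l) → ∃ λ i → v ≡ f i
  go []      v∈ = contradiction v∈ ∉⊥
  go (i ∷ l) v∈ with x∈p∪q⁻ ⁅ f i ⁆ _ v∈
  ... | inj₁ v∈⁅fi⁆ = i , x∈⁅y⁆⇒x≡y (f i) v∈⁅fi⁆
  ... | inj₂ v∈⋃    = go l v∈⋃

-- Channels as the sets with all degrees even.

odd-neighbours : ∀ (H : Graph N) C v → odd ∣ neighbours H v ∩ C ∣ ≡ degree H C v
odd-neighbours H C v = trans (odd-∣∣ (neighbours H v ∩ C)) (sum-cong-≗ λ u →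
  trans (Vec.lookup-zipWith _∧_ u (neighbours H v) C)
        (cong (_∧ lookup C u) (Vec.lookup∘tabulate (λ x → does (adj? H v x)) u)))

-- A vertex off `V H` has no neighbours, so the degree vanishes on all of `Fin N`.
channel-degree : ∀ (H : Graph N) {C} → IsChannel H C → ∀ v → degree H C v ≡ false
channel-degree H {C} (_ , even) v with v ∈? V H
... | yes v∈V = trans (sym (odd-neighbours H C v)) (2∣⇒even (even v v∈V))
... | no  v∉V = sum-const-false λ u →
  cong (_∧ lookup C u) (dec-false (adj? H v u) λ vu → v∉V (Adj⇒∈V H vu))

degree-channel : ∀ (H : Graph N) {C} → C ⊆ V H → (∀ v → v ∈ V H → degree H C v ≡ false) → IsChannel H C
degree-channel H {C} C⊆V deg = C⊆V , λ v v∈V → even⇒2∣ _ (trans (odd-neighbours H C v) (deg v v∈V))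

-- Adding 𝔽₂-linear combinations of the Bᵢ.

module Combination {n : ℕ} (B : Fin n → Subset N) where

  combine : (Fin n → Bool) → Subset N → Subset N
  combine t x = tabulate λ v → lookup x v xor sum (λ i → t i ∧ lookup (B i) v)

  lookup-combine : ∀ t x v → lookup (combine t x) v ≡ lookup x v xor sum (λ i → t i ∧ lookup (B i) v)
  lookup-combine t x v = Vec.lookup∘tabulate _ v

  combine-cong : ∀ {t s} x → t ≗ s → combine t x ≡ combine s x
  combine-cong x t≗s = Vec.tabulate-cong λ v →
    cong (lookup x v xor_) (sum-cong-≗ λ i → cong (_∧ lookup (B i) v) (t≗s i))

  -- A combination added twice cancels in characteristic two. Two maps of this kind are therefore
  -- inverse once their coefficients agree.
  combine-involutive : ∀ t x → combine t (combine t x) ≡ x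
  combine-involutive t x = trans (Vec.tabulate-cong pointwise) (Vec.tabulate∘lookup x)
    where
    pointwise : ∀ v → lookup (combine t x) v xor sum (λ i → t i ∧ lookup (B i) v) ≡ lookup x v
    pointwise v = begin
      lookup (combine t x) v xor s      ≡⟨ cong (_xor s) (lookup-combine t x v) ⟩
      (lookup x v xor s) xor s          ≡⟨ xor-assoc (lookup x v) s s ⟩
      lookup x v xor (s xor s)          ≡⟨ cong (lookup x v xor_) (xor-same s) ⟩
      lookup x v xor false              ≡⟨ xor-identityʳ _ ⟩
      lookup x v                        ∎
      where s = sum (λ i → t i ∧ lookup (B i) v)

  ∈-combine⁻ : ∀ t x {v} → v ∈ combine t x → v ∈ x ⊎ ∃ λ i → v ∈ B i
  ∈-combine⁻ t x {v} v∈ with v ∈? x | any? (λ i → v ∈? B i)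
  ... | yes v∈x | _        = inj₁ v∈x
  ... | no _    | yes v∈B  = inj₂ v∈B
  ... | no v∉x  | no v∉B   = contradiction v∈ (lookup-false⇒∉ (trans (lookup-combine t x v)
    (cong₂ _xor_ (∉⇒lookup v∉x) (sum-const-false λ i →
      trans (cong (t i ∧_) (∉⇒lookup λ v∈Bi → v∉B (i , v∈Bi))) (∧-zeroʳ (t i))))))

  -- The degree is linear in the set over 𝔽₂; the sums over vertices and over i are exchanged.
  degree-combine : ∀ (H : Graph N) t x v →
    degree H (combine t x) v ≡ degree H x v xor sum (λ i → t i ∧ degree H (B i) v)
  degree-combine H t x v = begin
    sum (λ u → a u ∧ lookup (combine t x) u)
      ≡⟨ sum-cong-≗ (λ u → trans (cong (a u ∧_) (lookup-combine t x u))
           (∧-distribˡ-xor (a u) (lookup x u) (sum (λ i → t i ∧ lookup (B i) u)))) ⟩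
    sum (λ u → (a u ∧ lookup x u) xor (a u ∧ sum (λ i → t i ∧ lookup (B i) u)))
      ≡⟨ ∑-distrib-+ (λ u → a u ∧ lookup x u) (λ u → a u ∧ sum (λ i → t i ∧ lookup (B i) u)) ⟩
    degree H x v xor sum (λ u → a u ∧ sum (λ i → t i ∧ lookup (B i) u))
      ≡⟨ cong (degree H x v xor_) swap ⟩
    degree H x v xor sum (λ i → t i ∧ degree H (B i) v) ∎
    where
    a : Fin N → Bool
    a u = does (adj? H v u)

    swap : sum (λ u → a u ∧ sum (λ i → t i ∧ lookup (B i) u)) ≡ sum (λ i → t i ∧ degree H (B i) v)
    swap = begin
      sum (λ u → a u ∧ sum (λ i → t i ∧ lookup (B i) u))
        ≡⟨ sum-cong-≗ (λ u → trans (*-distribˡ-sum (a u) (λ i → t i ∧ lookup (B i) u))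
             (sum-cong-≗ (λ i → ∧-swap (a u) (t i) (lookup (B i) u)))) ⟩
      sum (λ u → sum (λ i → t i ∧ (a u ∧ lookup (B i) u)))
        ≡⟨ ∑-comm (λ u i → t i ∧ (a u ∧ lookup (B i) u)) ⟩
      sum (λ i → sum (λ u → t i ∧ (a u ∧ lookup (B i) u)))
        ≡⟨ sum-cong-≗ (λ i → *-distribˡ-sum (t i) (λ u → a u ∧ lookup (B i) u)) ⟨
      sum (λ i → t i ∧ degree H (B i) v) ∎
      where
      ∧-swap : ∀ x y z → x ∧ (y ∧ z) ≡ y ∧ (x ∧ z)
      ∧-swap true  y z = refl
      ∧-swap false y z = sym (∧-zeroʳ y)

-- The degrees of the Bᵢ in G.

module _ (G : BipartiteGraph N) (b w : Fin n → Fin N) where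

  open BipartiteGraph G

  private
    e : Fin n → Edge N
    e i = b i , w i
    Gᵉ = G -edges e
    gᵉ = BipartiteGraph.graph Gᵉ
    G′ = G -vertices (image b ∪ image w)
    g′ = BipartiteGraph.graph G′

  module _
    (b~w : ∀ i → Adj graph (b i) (w i))
    (b-black : ∀ i → colour (b i) ≡ black)
    (w-white : ∀ i → colour (w i) ≡ white)
    (disjoint : ∀ i j → i ≢ j → VertexDisjoint (e i) (e j))
    (B : Fin n → Subset N)
    (B-channel : ∀ i → IsBlackChannel Gᵉ (B i))
    (B∩b⊆ : ∀ i → B i ∩ image b ⊆ ⁅ b i ⁆)
    where

    open Combination B

    b-injective : ∀ {i j} → b i ≡ b j → i ≡ j
    b-injective {i} {j} eq = decidable-stable (i ≟ j) λ i≢j →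
      disjoint i j i≢j (b i , inj₁ refl , inj₁ eq)

    w-injective : ∀ {i j} → w i ≡ w j → i ≡ j
    w-injective {i} {j} eq = decidable-stable (i ≟ j) λ i≢j →
      disjoint i j i≢j (w i , inj₂ refl , inj₂ eq)

    black≢w : ∀ {v} j → colour v ≡ black → v ≢ w j
    black≢w j v-black refl = contradiction (trans (sym v-black) (w-white j)) λ ()

    B⊆V : ∀ i → B i ⊆ V graph
    B⊆V i = proj₁ (proj₁ (B-channel i))

    B-black : ∀ i {v} → v ∈ B i → colour v ≡ black
    B-black i v∈B = proj₂ (B-channel i) _ v∈B

    b∈B⇒≡ : ∀ {i j} → b j ∈ B i → j ≡ i
    b∈B⇒≡ {i} {j} bj∈B = b-injective (x∈⁅y⁆⇒x≡y (b i) (B∩b⊆ i (x∈p∩q⁺ (bj∈B , ∈-image⁺ b j))))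

    adj-Gᵉ : ∀ {x v} → (∀ i → ¬ (x , v) ≐ e i) → does (adj? graph x v) ≡ does (adj? gᵉ x v)
    adj-Gᵉ {x} {v} ∉e = does-⇔ (mk⇔ (_, ∉e) proj₁) (adj? graph x v) (adj? gᵉ x v)

    -- G exceeds Gᵉ by the edges eⱼ. A member of Bᵢ is black, so it can meet eⱼ only as bⱼ, which
    -- forces j = i. Hence only the pair wᵢ, bᵢ can change the even degrees of Gᵉ.
    degree-B : ∀ i x → degree graph (B i) x ≡ does (x ≟ w i) ∧ lookup (B i) (b i)
    degree-B i x = begin
      degree graph (B i) x
        ≡⟨ sum-cong-≗ entry ⟩
      sum (λ v → (does (adj? gᵉ x v) ∧ lookup (B i) v) xor (does (v ≟ b i) ∧ (does (x ≟ w i) ∧ lookup (B i) v)))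
        ≡⟨ ∑-distrib-+ (λ v → does (adj? gᵉ x v) ∧ lookup (B i) v)
                       (λ v → does (v ≟ b i) ∧ (does (x ≟ w i) ∧ lookup (B i) v)) ⟩
      degree gᵉ (B i) x xor sum (λ v → does (v ≟ b i) ∧ (does (x ≟ w i) ∧ lookup (B i) v))
        ≡⟨ cong₂ _xor_ (channel-degree gᵉ (proj₁ (B-channel i)) x)
                       (sum-kronecker (b i) (λ v → does (x ≟ w i) ∧ lookup (B i) v)) ⟩
      does (x ≟ w i) ∧ lookup (B i) (b i) ∎
      where
      ∉e : ∀ {v} → v ∈ B i → ¬ (v ≡ b i × x ≡ w i) → ∀ j → ¬ (x , v) ≐ e j
      ∉e v∈B _  j (inj₁ (_ , v≡wj))       = black≢w j (B-black i v∈B) v≡wj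
      ∉e v∈B ≢e j (inj₂ (refl , refl)) with b∈B⇒≡ v∈B
      ... | refl = ≢e (refl , refl)

      entry : ∀ v → does (adj? graph x v) ∧ lookup (B i) v ≡
        (does (adj? gᵉ x v) ∧ lookup (B i) v) xor (does (v ≟ b i) ∧ (does (x ≟ w i) ∧ lookup (B i) v))
      entry v = aux (v ∈? B i) (v ≟ b i) (x ≟ w i)
        where
        kept : v ∈ B i → ¬ (v ≡ b i × x ≡ w i) → ∀ a → a ≡ false →
               does (adj? graph x v) ∧ lookup (B i) v ≡ (does (adj? gᵉ x v) ∧ lookup (B i) v) xor a
        kept v∈B ≢e _ refl = trans (cong (_∧ lookup (B i) v) (adj-Gᵉ (∉e v∈B ≢e))) (sym (xor-identityʳ _))

        aux : Dec (v ∈ B i) → (v? : Dec (v ≡ b i)) (x? : Dec (x ≡ w i)) →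
          does (adj? graph x v) ∧ lookup (B i) v ≡
          (does (adj? gᵉ x v) ∧ lookup (B i) v) xor (does v? ∧ (does x? ∧ lookup (B i) v))
        aux (no v∉B) v? x? rewrite ∉⇒lookup v∉B
          | ∧-zeroʳ (does (adj? graph x v)) | ∧-zeroʳ (does x?) | ∧-zeroʳ (does v?) =
          sym (trans (xor-identityʳ (does (adj? gᵉ x v) ∧ false)) (∧-zeroʳ (does (adj? gᵉ x v))))
        aux (yes v∈B) (no v≢)  x?      = kept v∈B (v≢ ∘ proj₁) false refl
        aux (yes v∈B) (yes _)  (no x≢) = kept v∈B (x≢ ∘ proj₂) false refl
        -- This is eᵢ itself, present in G and deleted in Gᵉ; the correction term restores it.
        aux (yes v∈B) (yes refl) (yes refl) = begin
          does (adj? graph x v) ∧ lookup (B i) v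
            ≡⟨ cong₂ _∧_ (dec-true (adj? graph x v) (symm graph (b~w i))) (Vec.[]=⇒lookup v∈B) ⟩
          true
            ≡⟨ cong₂ (λ a c → (a ∧ c) xor c)
                 (dec-false (adj? gᵉ x v) λ (_ , ∉e′) → ∉e′ i (inj₂ (refl , refl))) (Vec.[]=⇒lookup v∈B) ⟨
          (does (adj? gᵉ x v) ∧ lookup (B i) v) xor lookup (B i) v ∎

    -- The vertices of G′ and the coefficient at them.

    V′⁺ : ∀ {v} → v ∈ V graph → (∀ j → v ≢ b j) → (∀ j → v ≢ w j) → v ∈ V g′
    V′⁺ v∈V v≢b v≢w = x∈p∧x∉q⇒x∈p─q v∈V λ v∈∪ → ∉b⊎w (x∈p∪q⁻ (image b) (image w) v∈∪)
      where
      ∉b⊎w : ¬ (_ ∈ image b ⊎ _ ∈ image w)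
      ∉b⊎w (inj₁ v∈b) = let (j , v≡bj) = ∈-image⁻ b v∈b in v≢b j v≡bj
      ∉b⊎w (inj₂ v∈w) = let (j , v≡wj) = ∈-image⁻ w v∈w in v≢w j v≡wj

    V′⊆V : V g′ ⊆ V graph
    V′⊆V = p─q⊆p (V graph) (image b ∪ image w)

    V′⇒∉ : ∀ {v} → v ∈ V g′ → v ∉ image b ∪ image w
    V′⇒∉ = ∈─⇒∉ (V graph) (image b ∪ image w)

    V′⇒≢b : ∀ {v} → v ∈ V g′ → ∀ j → v ≢ b j
    V′⇒≢b v∈V′ j refl = V′⇒∉ v∈V′ (x∈p∪q⁺ (inj₁ (∈-image⁺ b j)))

    V′⇒≢w : ∀ {v} → v ∈ V g′ → ∀ j → v ≢ w j
    V′⇒≢w v∈V′ j refl = V′⇒∉ v∈V′ (x∈p∪q⁺ (inj₂ (∈-image⁺ w j)))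

    adj-G′ : ∀ {u v} → u ∈ V g′ → v ∈ V g′ → Adj graph u v ⇔ Adj g′ u v
    adj-G′ u∈V′ v∈V′ = mk⇔ (λ uv → uv , V′⇒∉ u∈V′ , V′⇒∉ v∈V′) proj₁

    -- Inside V′ the two adjacencies agree, and both edge lists filter the same list of pairs.
    P-G′ : P (edges g′) (V g′) ≡ P (edges graph) (V g′)
    P-G′ = P-filter-cong
      (λ (u , v) → u <? v ×-dec adj? g′ u v) (λ (u , v) → u <? v ×-dec adj? graph u v)
      (List.cartesianProduct (allFin N) (allFin N)) (V g′)
      λ u v u∈V′ v∈V′ → cong (does (u <? v) ∧_) (sym (does-⇔
        (adj-G′ (Vec.lookup⇒[]= u _ u∈V′) (Vec.lookup⇒[]= v _ v∈V′)) (adj? graph u v) (adj? g′ u v)))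

    -- Removing the pairs bᵢ, wᵢ.

    -- The nested updates have the shape of the set produced by `P-remove`.
    without : List (Fin n) → Subset N
    without []      = V graph
    without (i ∷ l) = (without l [ b i ]≔ outside) [ w i ]≔ outside

    ∈-without⁺ : ∀ l {v} → v ∈ V graph → (∀ j → j ∈ᴸ l → v ≢ b j × v ≢ w j) → v ∈ without l
    ∈-without⁺ []      v∈V _ = v∈V
    ∈-without⁺ (i ∷ l) v∈V ≢ =
      ∈-≔⁺ (∈-≔⁺ (∈-without⁺ l v∈V λ j j∈l → ≢ j (there j∈l)) (proj₁ (≢ i (here refl)))) (proj₂ (≢ i (here refl)))

    ∈-without⁻ : ∀ l {v} → v ∈ without l → v ∈ V graph × (∀ j → j ∈ᴸ l → v ≢ b j × v ≢ w j)
    ∈-without⁻ []      v∈ = v∈ , λ _ ()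
    ∈-without⁻ (i ∷ l) v∈ =
      let (v∈₁ , v≢w) = ∈-≔⁻ v∈
          (v∈₂ , v≢b) = ∈-≔⁻ v∈₁
          (v∈V , ≢)   = ∈-without⁻ l v∈₂
      in v∈V , λ { _ (here refl) → v≢b , v≢w ; j (there j∈l) → ≢ j j∈l }

    without-all : without (allFin n) ≡ V g′
    without-all = ⊆-antisym
      (λ v∈ → let (v∈V , ≢) = ∈-without⁻ (allFin n) v∈ in
        V′⁺ v∈V (λ j → proj₁ (≢ j (∈-allFin j))) (λ j → proj₂ (≢ j (∈-allFin j))))
      (λ v∈V′ → ∈-without⁺ (allFin n) (V′⊆V v∈V′) λ j _ → V′⇒≢b v∈V′ j , V′⇒≢w v∈V′ j)

    -- When the pair i is removed, the rest of Bᵢ is still present: it contains no other bⱼ and no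
    -- white vertex. `Unique` ensures that bᵢ and wᵢ have not been removed before.
    P-without : (∀ i → b i ∈ B i) → ∀ l → Unique l → P (edges graph) (V graph) ≡ P (edges graph) (without l)
    P-without b∈B []      []         = refl
    P-without b∈B (i ∷ l) (i∉l ∷ l!) = trans (P-without b∈B l l!)
      (P-remove graph (B i) (b i) (w i) (b∈B i)
        (λ x → trans (degree-B i x) (cong (does (x ≟ w i) ∧_) (Vec.[]=⇒lookup (b∈B i))))
        (black≢w i (b-black i) ∘ sym) (without l)
        (∈-without⁺ l (Adj⇒∈V graph (b~w i)) λ j j∈l →
          (λ bi≡bj → All.lookup i∉l j∈l (b-injective bi≡bj)) , black≢w j (b-black i))
        (∈-without⁺ l (Adj⇒∈V graph (symm graph (b~w i))) λ j j∈l →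
          (black≢w i (b-black j) ∘ sym) , λ wi≡wj → All.lookup i∉l j∈l (w-injective wi≡wj))
        λ d d∈B d≢bi → ∈-without⁺ l (B⊆V i d∈B) λ j _ →
          (λ { refl → d≢bi (cong b (b∈B⇒≡ d∈B)) }) , black≢w j (B-black i d∈B))

    P-V≡P-V′ : (∀ i → Nonempty (B i)) → P (edges graph) (V graph) ≡ P (edges graph) (V g′)
    P-V≡P-V′ nonempty with all? (λ i → b i ∈? B i)
    ... | yes b∈B = trans (P-without b∈B (allFin n) (Unique.allFin⁺ n)) (cong (P (edges graph)) without-all)
    ... | no  b∉B with ¬∀⟶∃¬ n _ (λ i → b i ∈? B i) b∉B
    -- Such a Bᵢ avoids every bⱼ and every wⱼ, so it lies in V′ as well as in V, and both
    -- coefficients vanish.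
    ...   | i , bi∉B = trans (even (V graph) (B⊆V i)) (sym (even (V g′) λ v∈B →
        V′⁺ (B⊆V i v∈B) (λ { j refl → bi∉B (subst (λ k → b k ∈ B i) (b∈B⇒≡ v∈B) v∈B) })
          (λ j → black≢w j (B-black i v∈B))))
      where
      even = let (c , c∈B) = nonempty i in P-even graph (B i) c (w i) c∈B
        λ x → trans (degree-B i x) (cong (does (x ≟ w i) ∧_) (∉⇒lookup bi∉B))

    m≡m′ : (∀ i → Nonempty (B i)) → m graph % 2 ≡ m g′ % 2
    m≡m′ nonempty = odd≡⇒%2≡ (m graph) (m g′) (begin
      odd (m graph)                 ≡⟨ odd-m graph ⟩
      P (edges graph) (V graph)     ≡⟨ P-V≡P-V′ nonempty ⟩
      P (edges graph) (V g′)        ≡⟨ P-G′ ⟨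
      P (edges g′) (V g′)           ≡⟨ odd-m g′ ⟨
      odd (m g′)                    ∎)

    -- The bijection between the black channels of G and G′.

    module _ (b∈B : ∀ i → b i ∈ B i) where

      -- The matrix Bᵢ(bⱼ) is the identity, so adding Σ tᵢ Bᵢ changes the entry at bⱼ by exactly tⱼ.
      lookup-B : ∀ i j → lookup (B i) (b j) ≡ does (i ≟ j)
      lookup-B i j with i ≟ j
      ... | yes refl = Vec.[]=⇒lookup (b∈B i)
      ... | no  i≢j  = ∉⇒lookup (i≢j ∘ sym ∘ b∈B⇒≡)

      sum-kroneckerʳ : ∀ (t : Fin n → Bool) j → sum (λ i → t i ∧ does (i ≟ j)) ≡ t j
      sum-kroneckerʳ t j = trans (sum-cong-≗ λ i → Bool.∧-comm (t i) (does (i ≟ j))) (sum-kronecker j t)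

      combine-b : ∀ t x j → lookup (combine t x) (b j) ≡ lookup x (b j) xor t j
      combine-b t x j = trans (lookup-combine t x (b j)) (cong (lookup x (b j) xor_)
        (trans (sum-cong-≗ λ i → cong (t i ∧_) (lookup-B i j)) (sum-kroneckerʳ t j)))

      -- The degree vector of Bᵢ is the unit vector at wᵢ, so adding Σ tᵢ Bᵢ changes the degree at
      -- wⱼ by tⱼ and no other degree.
      degree-B′ : ∀ i x → degree graph (B i) x ≡ does (x ≟ w i)
      degree-B′ i x = trans (degree-B i x)
        (trans (cong (does (x ≟ w i) ∧_) (Vec.[]=⇒lookup (b∈B i))) (∧-identityʳ _))

      degree-combine-w : ∀ t x j → degree graph (combine t x) (w j) ≡ degree graph x (w j) xor t j
      degree-combine-w t x j = trans (degree-combine graph t x (w j)) (cong (degree graph x (w j) xor_)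
        (trans (sum-cong-≗ λ i → cong (t i ∧_) (trans (degree-B′ i (w j))
          (does-⇔ (mk⇔ (sym ∘ w-injective) (cong w ∘ sym)) (w j ≟ w i) (i ≟ j)))) (sum-kroneckerʳ t j)))

      degree-combine-≢w : ∀ t x {v} → (∀ i → v ≢ w i) → degree graph (combine t x) v ≡ degree graph x v
      degree-combine-≢w t x {v} v≢w = trans (degree-combine graph t x v)
        (trans (cong (degree graph x v xor_) (sum-const-false λ i → trans
          (cong (t i ∧_) (trans (degree-B′ i v) (dec-false (v ≟ w i) (v≢w i)))) (∧-zeroʳ (t i)))) (xor-identityʳ _))

      combine-black : ∀ t x → (∀ v → v ∈ x → colour v ≡ black) → ∀ v → v ∈ combine t x → colour v ≡ black
      combine-black t x x-black v v∈ with ∈-combine⁻ t x v∈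
      ... | inj₁ v∈x       = x-black v v∈x
      ... | inj₂ (i , v∈B) = B-black i v∈B

      combine-⊆V : ∀ t x → x ⊆ V graph → combine t x ⊆ V graph
      combine-⊆V t x x⊆V v∈ with ∈-combine⁻ t x v∈
      ... | inj₁ v∈x       = x⊆V v∈x
      ... | inj₂ (i , v∈B) = B⊆V i v∈B

      degree-G′ : ∀ x → x ⊆ V g′ → ∀ {v} → v ∈ V g′ → degree graph x v ≡ degree g′ x v
      degree-G′ x x⊆V′ {v} v∈V′ = sum-cong-≗ entry
        where
        entry : ∀ u → does (adj? graph v u) ∧ lookup x u ≡ does (adj? g′ v u) ∧ lookup x u
        entry u = aux (u ∈? x)
          where
          aux : Dec (u ∈ x) → does (adj? graph v u) ∧ lookup x u ≡ does (adj? g′ v u) ∧ lookup x u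
          aux (yes u∈x) = cong (_∧ lookup x u) (does-⇔ (adj-G′ v∈V′ (x⊆V′ u∈x)) (adj? graph v u) (adj? g′ v u))
          aux (no u∉x) rewrite ∉⇒lookup u∉x = trans (∧-zeroʳ _) (sym (∧-zeroʳ _))

      -- Neighbours of a black vertex are white. This settles the vertices bⱼ, about which channels
      -- of G′ say nothing.
      degree-black : ∀ x → (∀ v → v ∈ x → colour v ≡ black) → ∀ {v} → colour v ≡ black → degree graph x v ≡ false
      degree-black x x-black {v} v-black = sum-const-false entry
        where
        entry : ∀ u → does (adj? graph v u) ∧ lookup x u ≡ false
        entry u with u ∈? x
        ... | yes u∈x = cong (_∧ lookup x u) (dec-false (adj? graph v u) λ vu →
                          proper vu (trans v-black (sym (x-black u u∈x))))
        ... | no u∉x  = trans (cong (does (adj? graph v u) ∧_) (∉⇒lookup u∉x)) (∧-zeroʳ _)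

      clear-b : Subset N → Subset N
      clear-b x = combine (λ i → lookup x (b i)) x

      fix-w : Subset N → Subset N
      fix-w y = combine (λ i → degree graph y (w i)) y

      clear-b-channel : ∀ {x} → IsBlackChannel G x → IsBlackChannel G′ (clear-b x)
      clear-b-channel {x} (x-channel , x-black) =
        degree-channel g′ ⊆V′ (λ v v∈V′ → begin
          degree g′ (clear-b x) v       ≡⟨ degree-G′ (clear-b x) ⊆V′ v∈V′ ⟨
          degree graph (clear-b x) v    ≡⟨ degree-combine-≢w _ x (V′⇒≢w v∈V′) ⟩
          degree graph x v              ≡⟨ channel-degree graph x-channel v ⟩
          false                         ∎) ,
        combine-black _ x x-black
        where
        ⊆V′ : clear-b x ⊆ V g′
        -- The entry at bⱼ becomes x(bⱼ) + x(bⱼ) = 0, and a black set contains no wⱼ.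
        ⊆V′ {v} v∈ = V′⁺ (combine-⊆V _ x (proj₁ x-channel) v∈)
          (λ { j refl → lookup-false⇒∉ (trans (combine-b _ x j) (xor-same (lookup x (b j)))) v∈ })
          (λ j → black≢w j (combine-black _ x x-black v v∈))

      fix-w-channel : ∀ {y} → IsBlackChannel G′ y → IsBlackChannel G (fix-w y)
      fix-w-channel {y} (y-channel , y-black) =
        degree-channel graph (combine-⊆V _ y (V′⊆V ∘ proj₁ y-channel)) even , combine-black _ y y-black
        where
        even : ∀ v → v ∈ V graph → degree graph (fix-w y) v ≡ false
        -- At wⱼ the degree of y is added to itself, at bⱼ the colours decide, and any other vertex
        -- lies in V′ and keeps its even degree from G′.
        even v v∈V with any? (λ j → v ≟ w j) | any? (λ j → v ≟ b j)
        ... | yes (j , refl) | _ = trans (degree-combine-w _ y j) (xor-same (degree graph y (w j)))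
        ... | no _   | yes (j , refl) = degree-black (fix-w y) (combine-black _ y y-black) (b-black j)
        ... | no v≢w | no v≢b = begin
          degree graph (fix-w y) v   ≡⟨ degree-combine-≢w _ y (λ j v≡wj → v≢w (j , v≡wj)) ⟩
          degree graph y v           ≡⟨ degree-G′ y (proj₁ y-channel)
                                          (V′⁺ v∈V (λ j v≡bj → v≢b (j , v≡bj)) (λ j v≡wj → v≢w (j , v≡wj))) ⟩
          degree g′ y v              ≡⟨ channel-degree g′ y-channel v ⟩
          false                      ∎

      fix-w∘clear-b : ∀ {x} → IsBlackChannel G x → fix-w (clear-b x) ≡ x
      fix-w∘clear-b {x} (x-channel , _) = trans
        -- x has degree 0 at wⱼ, so `clear-b x` has degree x(bⱼ) there: `fix-w` adds back the same
        -- combination.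
        (combine-cong (clear-b x) λ j → trans (degree-combine-w _ x j)
          (cong (_xor lookup x (b j)) (channel-degree graph x-channel (w j))))
        (combine-involutive _ x)

      clear-b∘fix-w : ∀ {y} → IsBlackChannel G′ y → clear-b (fix-w y) ≡ y
      clear-b∘fix-w {y} (y-channel , _) = trans
        -- y avoids bⱼ, so the entry of `fix-w y` at bⱼ is the coefficient just added, the degree of
        -- y at wⱼ.
        (combine-cong (fix-w y) λ j → trans (combine-b _ y j)
          (cong (_xor degree graph y (w j)) (∉⇒lookup λ bj∈y → V′⇒≢b (proj₁ y-channel bj∈y) j refl)))
        (combine-involutive _ y)

      ∣𝒞ᴮ∣≡ : ∣𝒞ᴮ G ∣ ≡ ∣𝒞ᴮ G′ ∣
      ∣𝒞ᴮ∣≡ = countSubsets-bijection (isBlackChannel? G) (isBlackChannel? G′) clear-b fix-w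
        clear-b-channel fix-w-channel fix-w∘clear-b clear-b∘fix-w

theorem5p7 : ∀ {N n : ℕ} (G : BipartiteGraph N) (b w : Fin n → Fin N) →
    let open BipartiteGraph G
        e : Fin n → Edge N
        e = λ i → b i , w i
        Gᵉ = G -edges e
        G′ = G -vertices (image b ∪ image w)
    in
    (∀ i → Graph.Adj graph (b i) (w i)) →
    (∀ i → colour (b i) ≡ black) →
    (∀ i → colour (w i) ≡ white) →
    (∀ i j → i ≢ j → VertexDisjoint (e i) (e j)) →
    (B : Fin n → Subset N) →
    (∀ i → IsBlackChannel Gᵉ (B i)) →
    (∀ i → Nonempty (B i)) →
    (∀ i → B i ∩ image b ⊆ ⁅ b i ⁆) →
    (m graph % 2 ≡ m (BipartiteGraph.graph G′) % 2) ×
    ((∀ i → B i ∩ image b ≡ ⁅ b i ⁆) → ∣𝒞ᴮ G ∣ ≡ ∣𝒞ᴮ G′ ∣)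
theorem5p7 G b w b~w b-black w-white disjoint B B-channel nonempty B∩b⊆ =
  m≡m′ G b w b~w b-black w-white disjoint B B-channel B∩b⊆ nonempty ,
  λ B∩b≡ → ∣𝒞ᴮ∣≡ G b w b~w b-black w-white disjoint B B-channel B∩b⊆ λ i →
    proj₁ (x∈p∩q⁻ (B i) (image b) (subst (b i ∈_) (sym (B∩b≡ i)) (x∈⁅x⁆ (b i))))
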